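{- Let $n\geq 1$. Let $a(n)$ be the number of partitions of $n$ whose set of even parts has exactly one element; let $c(n)$ be the number of partitions of $n$ in which exactly one part is repeated; and let $b(n)$ be the total number of parts in all partitions of $n$ into odd parts minus the total number of parts in all partitions of $n$ into distinct parts. Then (i) $a(n)=b(n)$, and (ii) $c(n)=b(n)$.
   Context: A partition of $n$ is a non-increasing sequence of positive integers (its parts) summing to $n$; parts are counted with multiplicity. "The set of even parts has exactly one element" means exactly one distinct even value occurs among the parts; that value may occur with any positive multiplicity, and odd parts are unrestricted. "Exactly one part is repeated" means exactly one distinct value occurs with multiplicity at least $2$. -}

module Defs where

open import Data.Nat using (ℕ; zero; suc; _≤_; _≥_; _<_)
import Data.Nat
import Relation.Nullary
open import Data.Nat.Base using (_%_)
open import Data.List using (List; []; _∷_; length; map)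
open import Data.Nat.ListAction using (sum)
open import Data.List.Relation.Unary.All using (All)
open import Data.List.Relation.Unary.Linked using (Linked)
open import Data.List.Relation.Unary.AllPairs using (AllPairs)
open import Data.List.Relation.Unary.Unique.Propositional using (Unique)
open import Data.List.Membership.Propositional using (_∈_)
open import Data.Product using (_×_; ∃-syntax)
open import Relation.Binary.PropositionalEquality using (_≡_; _≢_)
open import Relation.Nullary using (¬_)

record IsPartition (n : ℕ) (λs : List ℕ) : Set where
  field
    nonIncreasing : Linked _≥_ λs
    positive      : All (λ p → 1 ≤ p) λs
    sums          : sum λs ≡ n

Even Odd : ℕ → Set
Even k = k % 2 ≡ 0
Odd  k = k % 2 ≡ 1

mult : ℕ → List ℕ → ℕ
mult v []       = 0
mult v (x ∷ xs) with v Data.Nat.≟ x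
... | Relation.Nullary.yes _ = suc (mult v xs)
... | Relation.Nullary.no  _ = mult v xs

ExactlyOneEvenValue : List ℕ → Set
ExactlyOneEvenValue λs = ∃[ e ] (Even e × e ∈ λs × All (λ p → Even p → p ≡ e) λs)

ExactlyOneRepeated : List ℕ → Set
ExactlyOneRepeated λs = ∃[ r ] (2 ≤ mult r λs × (∀ v → 2 ≤ mult v λs → v ≡ r))

AllOdd : List ℕ → Set
AllOdd λs = All Odd λs

Distinct : List ℕ → Set
Distinct λs = Unique λs

Enumerates : (ℕ → List ℕ → Set) → ℕ → List (List ℕ) → Set
Enumerates P n L = Unique L × (∀ λs → λs ∈ L → IsPartition n λs × P n λs)
                             × (∀ λs → IsPartition n λs → P n λs → λs ∈ L)

totalParts : List (List ℕ) → ℕ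
totalParts L = sum (map length L)

{-# OPTIONS --safe #-}
module Submission where

-- Let O and D be the generating functions of partitions into odd and into distinct parts; O = D by Euler, and
-- Glaisher's bijection preserves any separate block of j copies of a part k. With E = Σ q²ᵏ/(1 − q²ᵏ) (blocks of
-- even k) and F the same sum over odd k, splitting off the even parts gives a = O·E and splitting off the copies
-- of a repeated part gives c = D·E. Adjoining a block of j copies of k to a distinct partition yields either a
-- distinct partition with a selected part, or a partition counted by c, each of the latter arising twice (the
-- multiplicity m of the repeated part is m + 0 or (m − 1) + 1). Hence, with o and d the total numbers of parts,
-- a + o = O·(E + F) = D·(E + F) = d + 2c, and a = c.

open import Defs
open import Data.Nat using (ℕ; zero; suc; _≤_; _≥_; _<_; _+_; _*_; _∸_; _/_; _%_; z≤n; s≤s; _≟_; _≤?_)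
open import Data.Nat.Properties
open import Data.Nat.DivMod using (m≡m%n+[m/n]*n; m%n<n; m*n%n≡0; m*n/n≡m; m/n*n≤m; m%n≡m∸m/n*n)
open import Data.Nat.ListAction using (sum)
open import Data.Nat.ListAction.Properties using (sum-++; sum-↭)
import Data.Integer.Properties as ℤ
open import Data.List using (List; []; _∷_; _++_; length; map; filter; replicate)
open import Data.List.Properties using (length-++; length-map; filter-accept; filter-reject)
open import Data.List.Membership.Propositional using (_∈_)
open import Data.List.Membership.Propositional.Properties using (∈-++⁺ˡ; ∈-++⁺ʳ; ∈-++⁻; ∈-map⁺; ∈-map⁻)
open import Data.List.Membership.Propositional.Properties.WithK using (unique∧set⇒bag)
open import Data.List.Relation.Binary.BagAndSetEquality using (∼bag⇒↭)
open import Data.List.Relation.Binary.Permutation.Propositional using (_↭_; ↭-sym)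
open import Data.List.Relation.Binary.Permutation.Propositional.Properties using (filter-↭; ↭-length; All-resp-↭)
open import Data.List.Relation.Unary.All as All using (All; []; _∷_)
import Data.List.Relation.Unary.All.Properties as All
open import Data.List.Relation.Unary.AllPairs as AllPairs using ([]; _∷_)
import Data.List.Relation.Unary.AllPairs.Properties as AllPairs
open import Data.List.Relation.Unary.Any using (here; there)
open import Data.List.Relation.Unary.Linked as Linked using (Linked)
import Data.List.Relation.Unary.Linked.Properties as Linked
open import Data.List.Relation.Unary.Unique.Propositional using (Unique)
import Data.List.Relation.Unary.Unique.Propositional.Properties as Unique
import Data.List.Sort as Sort
open import Data.Product using (_×_; _,_; ∃; proj₁; proj₂)
open import Data.Sum as Sum using (_⊎_; inj₁; inj₂)
open import Data.Unit using (⊤; tt)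
open import Function using (id; _∘_)
open import Function.Bundles using (mk⇔)
open import Relation.Binary.Construct.Flip.EqAndOrd using (decTotalOrder)
open import Relation.Binary.PropositionalEquality
open import Relation.Nullary using (¬_; yes; no; contradiction)
open import Relation.Nullary.Decidable using (¬?)

open Sort (decTotalOrder ≤-decTotalOrder) using (sort; sort-↭; sort-↗)

-- Finite cardinalities and their transfer along bijections

private
  variable
    X Y : Set
    P Q : X → Set
    a b : ℕ

-- The count is witnessed by a list, so that bijections transport it without a decision procedure
-- for `P`.
record Card {X : Set} (P : X → Set) (m : ℕ) : Set where
  field
    elements : List X
    unique   : Unique elements
    sound    : All P elements
    complete : ∀ {x} → P x → x ∈ elements
    size     : length elements ≡ m

-- Two duplicate-free lists with the same members agree as bags, hence are permutations of each
-- other.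
card-unique : Card P a → Card P b → a ≡ b
card-unique c d = trans (sym (size c)) (trans (↭-length same) (size d))
  where
  open Card
  same = ∼bag⇒↭ (unique∧set⇒bag (unique c) (unique d)
           (mk⇔ (complete d ∘ All.lookup (sound c)) (complete c ∘ All.lookup (sound d))))

card-⊎ : Card P a → Card Q b → (∀ {x} → P x → ¬ Q x) → Card (λ x → P x ⊎ Q x) (a + b)
card-⊎ {P = P} {Q = Q} c d disjoint = record
  { elements = elements c ++ elements d
  ; unique   = Unique.++⁺ (unique c) (unique d)
                 (λ (x∈c , x∈d) → disjoint (All.lookup (sound c) x∈c) (All.lookup (sound d) x∈d))
  ; sound    = All.++⁺ (All.map inj₁ (sound c)) (All.map inj₂ (sound d))
  ; complete = λ { (inj₁ p) → ∈-++⁺ˡ (complete c p) ; (inj₂ q) → ∈-++⁺ʳ (elements c) (complete d q) }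
  ; size     = trans (length-++ (elements c)) (cong₂ _+_ (size c) (size d))
  }
  where open Card

-- The listed elements of `Q` are pulled back one by one through `onto`. The preimages are distinct
-- because their images are; injectivity on `P` is what makes the resulting list complete.
card-pullback : (f : X → Y) → (∀ {x} → P x → Q (f x)) →
  (∀ {x x′} → P x → P x′ → f x ≡ f x′ → x ≡ x′) →
  (∀ {y} → Q y → ∃ λ x → P x × f x ≡ y) →
  Card Q a → Card P a
card-pullback {P = P} {Q = Q} f to injective onto c with preimages (sound c)
  where
  open Card
  preimages : ∀ {ys} → All Q ys → ∃ λ xs → All P xs × map f xs ≡ ys
  preimages []       = [] , [] , refl
  preimages (q ∷ qs) with onto q | preimages qs
  ... | x , p , refl | xs , ps , refl = x ∷ xs , p ∷ ps , refl
... | xs , ps , eq = record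
  { elements = xs
  ; unique   = AllPairs.map (λ ne x≡y → ne (cong f x≡y)) (AllPairs.map⁻ (subst Unique (sym eq) (unique c)))
  ; sound    = ps
  ; complete = complete′
  ; size     = trans (sym (length-map f xs)) (trans (cong length eq) (size c))
  }
  where
  open Card
  complete′ : ∀ {x} → P x → x ∈ xs
  complete′ p with ∈-map⁻ f (subst (_ ∈_) (sym eq) (complete c (to p)))
  ... | x′ , x′∈ , fx≡ with injective p (All.lookup ps x′∈) fx≡
  ... | refl = x′∈

card-⇔ : (∀ {x} → P x → Q x) → (∀ {x} → Q x → P x) → Card Q a → Card P a
card-⇔ to from = card-pullback id to (λ _ _ → id) (λ q → _ , from q , refl)

-- Multiplicities of values in lists

mult-here : ∀ x xs → mult x (x ∷ xs) ≡ suc (mult x xs)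
mult-here x xs with x ≟ x
... | yes _ = refl
... | no ne = contradiction refl ne

mult-skip : ∀ {v x} xs → v ≢ x → mult v (x ∷ xs) ≡ mult v xs
mult-skip {v} {x} xs ne with v ≟ x
... | yes eq = contradiction eq ne
... | no _ = refl

mult-filter : ∀ v xs → mult v xs ≡ length (filter (v ≟_) xs)
mult-filter v [] = refl
mult-filter v (x ∷ xs) with v ≟ x
... | yes eq = trans (cong suc (mult-filter v xs)) (sym (cong length (filter-accept (v ≟_) eq)))
... | no ne  = trans (mult-filter v xs) (sym (cong length (filter-reject (v ≟_) ne)))

mult-↭ : ∀ v {xs ys} → xs ↭ ys → mult v xs ≡ mult v ys
mult-↭ v {xs} {ys} p = trans (mult-filter v xs) (trans (↭-length (filter-↭ (v ≟_) p)) (sym (mult-filter v ys)))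

mult-++ : ∀ v xs ys → mult v (xs ++ ys) ≡ mult v xs + mult v ys
mult-++ v [] ys = refl
mult-++ v (x ∷ xs) ys with v ≟ x
... | yes _ = cong suc (mult-++ v xs ys)
... | no _  = mult-++ v xs ys

mult-replicate : ∀ k j → mult k (replicate j k) ≡ j
mult-replicate k zero = refl
mult-replicate k (suc j) = trans (mult-here k _) (cong suc (mult-replicate k j))

mult-replicate-≢ : ∀ {v k} j → v ≢ k → mult v (replicate j k) ≡ 0
mult-replicate-≢ zero ne = refl
mult-replicate-≢ (suc j) ne = trans (mult-skip _ ne) (mult-replicate-≢ j ne)

sum-replicate : ∀ j k → sum (replicate j k) ≡ j * k
sum-replicate zero k = refl
sum-replicate (suc j) k = cong (k +_) (sum-replicate j k)

mult⇒∈ : ∀ {v} xs → 1 ≤ mult v xs → v ∈ xs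
mult⇒∈ {v} (x ∷ xs) le with v ≟ x
... | yes eq = here eq
... | no _   = there (mult⇒∈ xs le)

∈⇒mult : ∀ {v xs} → v ∈ xs → 1 ≤ mult v xs
∈⇒mult {v} {x ∷ xs} (here refl) = subst (1 ≤_) (sym (mult-here v xs)) (s≤s z≤n)
∈⇒mult {v} {x ∷ xs} (there i) with v ≟ x
... | yes _ = s≤s z≤n
... | no _  = ∈⇒mult i

∉⇒mult≡0 : ∀ {v} xs → ¬ (v ∈ xs) → mult v xs ≡ 0
∉⇒mult≡0 xs v∉ = n<1⇒n≡0 (≰⇒> (v∉ ∘ mult⇒∈ xs))

*-mult≤sum : ∀ v xs → v * mult v xs ≤ sum xs
*-mult≤sum v [] = ≤-reflexive (*-zeroʳ v)
*-mult≤sum v (x ∷ xs) with v ≟ x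
... | yes refl = ≤-trans (≤-reflexive (*-suc v _)) (+-monoʳ-≤ v (*-mult≤sum v xs))
... | no _     = ≤-trans (*-mult≤sum v xs) (m≤n+m _ x)

-- A single copy of `v` would already outweigh the whole list.
mult-beyond-sum : ∀ {v n} xs → sum xs ≤ n → n < v → mult v xs ≡ 0
mult-beyond-sum {v} xs s≤n n<v with mult v xs | *-mult≤sum v xs
... | zero  | _ = refl
... | suc m | h = contradiction (≤-trans (m≤m*n v (suc m)) (≤-trans h s≤n)) (<⇒≱ n<v)

-- Partitions as multiplicity functions

-- A partition of an unspecified number: the sum is tracked separately because adding and removing
-- blocks changes it.
Valid : List ℕ → Set
Valid xs = Linked _≥_ xs × All (1 ≤_) xs

head-max : ∀ {v x xs} → Linked _≥_ (x ∷ xs) → v ∈ x ∷ xs → v ≤ x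
head-max ls (here refl) = ≤-refl
head-max {xs = y ∷ ys} (r Linked.∷ ls) (there i) = ≤-trans (head-max ls i) r

-- Each head occurs in the other list and is therefore bounded by its head, so the heads agree and
-- can be cancelled. Equations between partitions thereby reduce to equations at each value.
mult-ext : ∀ {xs ys} → Linked _≥_ xs → Linked _≥_ ys → (∀ v → mult v xs ≡ mult v ys) → xs ≡ ys
mult-ext {[]} {[]} _ _ _ = refl
mult-ext {[]} {y ∷ ys} _ _ eq = contradiction (trans (eq y) (mult-here y ys)) λ ()
mult-ext {x ∷ xs} {[]} _ _ eq = contradiction (trans (sym (eq x)) (mult-here x xs)) λ ()
mult-ext {x ∷ xs} {y ∷ ys} lx ly eq
  with ≤-antisym (head-max ly (mult⇒∈ _ (subst (1 ≤_) (eq x) (∈⇒mult {x} {x ∷ xs} (here refl)))))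
                 (head-max lx (mult⇒∈ _ (subst (1 ≤_) (sym (eq y)) (∈⇒mult {y} {y ∷ ys} (here refl)))))
... | refl = cong (x ∷_) (mult-ext (Linked.tail lx) (Linked.tail ly) tails)
  where
  tails : ∀ v → mult v xs ≡ mult v ys
  tails v with v ≟ x | eq v
  ... | yes _ | e = suc-injective e
  ... | no _  | e = e

-- Adding and removing blocks of equal parts

-- `sort` uses the flipped order and so returns a non-increasing list; only multiplicities then need
-- to be followed.
add : ℕ → ℕ → List ℕ → List ℕ
add k j xs = sort (replicate j k ++ xs)

mult-add : ∀ v k j xs → mult v (add k j xs) ≡ mult v (replicate j k) + mult v xs
mult-add v k j xs = trans (mult-↭ v (sort-↭ _)) (mult-++ v (replicate j k) xs)

mult-add-≡ : ∀ k j xs → mult k (add k j xs) ≡ j + mult k xs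
mult-add-≡ k j xs = trans (mult-add k k j xs) (cong (_+ mult k xs) (mult-replicate k j))

mult-add-≢ : ∀ {v k} j xs → v ≢ k → mult v (add k j xs) ≡ mult v xs
mult-add-≢ {v} {k} j xs ne = trans (mult-add v k j xs) (cong (_+ mult v xs) (mult-replicate-≢ j ne))

sum-add : ∀ k j xs → sum (add k j xs) ≡ sum xs + k * j
sum-add k j xs = begin
  sum (add k j xs)               ≡⟨ sum-↭ (sort-↭ _) ⟩
  sum (replicate j k ++ xs)      ≡⟨ sum-++ (replicate j k) xs ⟩
  sum (replicate j k) + sum xs   ≡⟨ +-comm _ (sum xs) ⟩
  sum xs + sum (replicate j k)   ≡⟨ cong (sum xs +_) (trans (sum-replicate j k) (*-comm j k)) ⟩
  sum xs + k * j                 ∎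
  where open ≡-Reasoning

add-valid : ∀ {k} j {xs} → 1 ≤ k → Valid xs → Valid (add k j xs)
add-valid j 1≤k (_ , pos) = sort-↗ _ , All-resp-↭ (↭-sym (sort-↭ _)) (All.++⁺ (All.replicate⁺ j 1≤k) pos)

add-injective : ∀ k j {xs ys} → Valid xs → Valid ys → add k j xs ≡ add k j ys → xs ≡ ys
add-injective k j {xs} {ys} (lx , _) (ly , _) eq = mult-ext lx ly λ v →
  +-cancelˡ-≡ (mult v (replicate j k)) _ _
    (trans (sym (mult-add v k j xs)) (trans (cong (mult v) eq) (mult-add v k j ys)))

strip : ℕ → List ℕ → List ℕ
strip k = filter (λ x → ¬? (k ≟ x))

mult-strip-≡ : ∀ k xs → mult k (strip k xs) ≡ 0
mult-strip-≡ k xs = ∉⇒mult≡0 (strip k xs) (λ i → All.lookup (All.all-filter (λ x → ¬? (k ≟ x)) xs) i refl)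

mult-strip-≢ : ∀ {v k} xs → v ≢ k → mult v (strip k xs) ≡ mult v xs
mult-strip-≢ [] ne = refl
mult-strip-≢ {v} {k} (x ∷ xs) ne with k ≟ x
... | yes refl = begin
  mult v (strip k (k ∷ xs))  ≡⟨ cong (mult v) (filter-reject (λ x → ¬? (k ≟ x)) (λ k≢k → k≢k refl)) ⟩
  mult v (strip k xs)        ≡⟨ mult-strip-≢ xs ne ⟩
  mult v xs                  ≡⟨ mult-skip xs ne ⟨
  mult v (k ∷ xs)            ∎
  where open ≡-Reasoning
... | no k≢x = trans (cong (mult v) (filter-accept (λ x → ¬? (k ≟ x)) k≢x)) keep
  where
  keep : mult v (x ∷ strip k xs) ≡ mult v (x ∷ xs)
  keep with v ≟ x
  ... | yes _ = cong suc (mult-strip-≢ xs ne)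
  ... | no _  = mult-strip-≢ xs ne

-- Deleting every copy and restoring the surplus avoids choosing which copies go, and lets the
-- multiplicities be read off from `add` and `strip`.
remove : ℕ → ℕ → List ℕ → List ℕ
remove k j xs = add k (mult k xs ∸ j) (strip k xs)

mult-remove-≡ : ∀ k j xs → mult k (remove k j xs) ≡ mult k xs ∸ j
mult-remove-≡ k j xs = 
  trans (mult-add-≡ k (mult k xs ∸ j) (strip k xs)) (trans (cong (mult k xs ∸ j +_) (mult-strip-≡ k xs)) (+-identityʳ _))

mult-remove-≢ : ∀ {v k} j xs → v ≢ k → mult v (remove k j xs) ≡ mult v xs
mult-remove-≢ {k = k} j xs ne = trans (mult-add-≢ (mult k xs ∸ j) (strip k xs) ne) (mult-strip-≢ xs ne)

remove-valid : ∀ {k} j {xs} → 1 ≤ k → Valid xs → Valid (remove k j xs)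
remove-valid {k} j 1≤k (l , pos) =
  add-valid _ 1≤k (Linked.filter⁺ (λ x → ¬? (k ≟ x)) (λ p q → ≤-trans q p) l , All.filter⁺ _ pos)

add-remove : ∀ k {j xs} → Valid xs → j ≤ mult k xs → add k j (remove k j xs) ≡ xs
add-remove k {j} {xs} (l , _) j≤ = mult-ext (sort-↗ _) l same
  where
  same : ∀ v → mult v (add k j (remove k j xs)) ≡ mult v xs
  same v with v ≟ k
  ... | yes refl = trans (mult-add-≡ k j _) (trans (cong (_ +_) (mult-remove-≡ k j xs)) (m+[n∸m]≡n j≤))
  ... | no ne = trans (mult-add-≢ j _ ne) (mult-remove-≢ j xs ne)

-- `remove k j` is a right inverse of the injective map `add k j` on its image, hence also a left
-- inverse.
remove-add : ∀ {k} j {xs} → 1 ≤ k → Valid xs → remove k j (add k j xs) ≡ xs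
remove-add {k} j {xs} 1≤k v =
  add-injective k j (remove-valid j 1≤k (add-valid j 1≤k v)) v
    (add-remove k (add-valid j 1≤k v) (subst (j ≤_) (sym (mult-add-≡ k j xs)) (m≤m+n j _)))

sum-remove : ∀ k {j xs} → Valid xs → j ≤ mult k xs → sum (remove k j xs) + k * j ≡ sum xs
sum-remove k {j} v j≤ = trans (sym (sum-add k j _)) (cong sum (add-remove k v j≤))

mult⇒positive : ∀ {k xs} → Valid xs → 1 ≤ mult k xs → 1 ≤ k
mult⇒positive {xs = xs} (_ , pos) m = All.lookup pos (mult⇒∈ xs m)

mult-remove-≤ : ∀ v k j xs → mult v (remove k j xs) ≤ mult v xs
mult-remove-≤ v k j xs with v ≟ k
... | yes refl = ≤-trans (≤-reflexive (mult-remove-≡ k j xs)) (m∸n≤m _ j)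
... | no ne    = ≤-reflexive (mult-remove-≢ j xs ne)

mult≤mult-add : ∀ k j xs → j ≤ mult k (add k j xs)
mult≤mult-add k j xs = subst (j ≤_) (sym (mult-add-≡ k j xs)) (m≤m+n j _)

-- Parity

even⇒double : ∀ {k} → Even k → k ≡ k / 2 * 2
even⇒double {k} e = trans (m≡m%n+[m/n]*n k 2) (cong (_+ k / 2 * 2) e)

double-even : ∀ r → Even (r * 2)
double-even r = m*n%n≡0 r 2

even-odd-⊥ : ∀ {k} → Even k → ¬ Odd k
even-odd-⊥ e o with trans (sym e) o
... | ()

parity : ∀ k → Even k ⊎ Odd k
parity k with k % 2 | m%n<n k 2
... | 0 | _ = inj₁ refl
... | 1 | _ = inj₂ refl
... | suc (suc _) | s≤s (s≤s ())

-- Uniqueness of the quotient by 2. It recovers the even part of a multiplicity, and the number of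
-- broken parts in Glaisher's step.
double-+-injective : ∀ i j {b c} → b ≤ 1 → c ≤ 1 → i * 2 + b ≡ j * 2 + c → i ≡ j
double-+-injective zero zero _ _ _ = refl
double-+-injective zero (suc j) (s≤s ()) _ refl
double-+-injective (suc i) zero _ (s≤s ()) refl
double-+-injective (suc i) (suc j) b≤ c≤ eq =
  cong suc (double-+-injective i j b≤ c≤ (suc-injective (suc-injective eq)))

-- Odd and distinct parts in terms of multiplicities

-- Even values are written as doubles `r * 2` to match the form of `Partway`, which interpolates
-- between the two conditions.
OddParts DistinctParts : List ℕ → Set
OddParts xs      = ∀ r → mult (r * 2) xs ≡ 0
DistinctParts xs = ∀ v → mult v xs ≤ 1

allOdd⇒oddParts : ∀ {xs} → AllOdd xs → OddParts xs
allOdd⇒oddParts {xs} odd r = ∉⇒mult≡0 xs λ i → even-odd-⊥ {r * 2} (double-even r) (All.lookup odd i)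

oddParts⇒¬even : ∀ {v xs} → OddParts xs → Even v → mult v xs ≡ 0
oddParts⇒¬even {v} {xs} odd e = subst (λ w → mult w xs ≡ 0) (sym (even⇒double {v} e)) (odd (v / 2))

oddParts⇒allOdd : ∀ {xs} → OddParts xs → AllOdd xs
oddParts⇒allOdd {xs} odd = All.tabulate λ {v} i → isOdd v i (parity v)
  where
  isOdd : ∀ v → v ∈ xs → Even v ⊎ Odd v → Odd v
  isOdd v i (inj₂ o) = o
  isOdd v i (inj₁ e) = contradiction (oddParts⇒¬even {v} {xs} odd e) (≢-sym (<⇒≢ (∈⇒mult i)))

unique⇒distinctParts : ∀ {xs} → Distinct xs → DistinctParts xs
unique⇒distinctParts [] v = z≤n
unique⇒distinctParts {x ∷ xs} (x∉ ∷ u) v with v ≟ x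
... | yes refl = s≤s (≤-reflexive (∉⇒mult≡0 xs λ i → All.lookup x∉ i refl))
... | no _     = unique⇒distinctParts u v

distinctParts⇒unique : ∀ {xs} → DistinctParts xs → Distinct xs
distinctParts⇒unique {[]} d = []
distinctParts⇒unique {x ∷ xs} d = All.tabulate fresh ∷ distinctParts⇒unique (λ v → ≤-trans (weaken v) (d v))
  where
  fresh : ∀ {y} → y ∈ xs → x ≢ y
  fresh i refl = contradiction (≤-trans (s≤s (∈⇒mult i)) (≤-trans (≤-reflexive (sym (mult-here x xs))) (d x))) λ { (s≤s ()) }
  weaken : ∀ v → mult v xs ≤ mult v (x ∷ xs)
  weaken v with v ≟ x
  ... | yes _ = n≤1+n _
  ... | no _  = ≤-refl

valid : ∀ {n xs} → IsPartition n xs → Valid xs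
valid p = IsPartition.nonIncreasing p , IsPartition.positive p

partition : ∀ {n xs} → Valid xs → sum xs ≡ n → IsPartition n xs
partition (l , pos) eq = record { nonIncreasing = l ; positive = pos ; sums = eq }

card-enumerated : ∀ {K n L} → Enumerates (λ _ → K) n L → Card (λ xs → IsPartition n xs × K xs) (length L)
card-enumerated {L = L} (u , s , c) = record
  { elements = L
  ; unique   = u
  ; sound    = All.tabulate (s _)
  ; complete = λ (p , k) → c _ p k
  ; size     = refl
  }

-- Partitions with a separate block or a selected part

Triple : Set
Triple = List ℕ × ℕ × ℕ

-- Coefficients of products such as O(q) · Σ qᵏ/(1 − qᵏ): a partition together with a separate block of j copies of k.
data Marked (R : List ℕ → ℕ → ℕ → Set) (n : ℕ) : Triple → Set where
  marked : ∀ {xs k j} → Valid xs → 1 ≤ k → 1 ≤ j → R xs k j → sum xs + k * j ≡ n → Marked R n (xs , k , j)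

-- One of the parts of xs is selected: (k , j) stands for the j-th copy of k.
data Pointed (K : List ℕ → Set) (n : ℕ) : Triple → Set where
  pointed : ∀ {xs k j} → IsPartition n xs → K xs → 1 ≤ j → j ≤ mult k xs → Pointed K n (xs , k , j)

-- Equal parts are numbered from the right, so that the labels of value `k` are exactly 1 up to
-- `mult k xs`.
points : List ℕ → List (ℕ × ℕ)
points []       = []
points (x ∷ xs) = (x , suc (mult x xs)) ∷ points xs

length-points : ∀ xs → length (points xs) ≡ length xs
length-points []       = refl
length-points (x ∷ xs) = cong suc (length-points xs)

∈-points⁻ : ∀ {k j} xs → (k , j) ∈ points xs → 1 ≤ j × j ≤ mult k xs
∈-points⁻ (x ∷ xs) (here refl) = s≤s z≤n , ≤-reflexive (sym (mult-here x xs))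
∈-points⁻ {k} (x ∷ xs) (there i) with k ≟ x | ∈-points⁻ xs i
... | yes _ | p , q = p , m≤n⇒m≤1+n q
... | no _  | pq = pq

∈-points⁺ : ∀ {k j} xs → 1 ≤ j → j ≤ mult k xs → (k , j) ∈ points xs
∈-points⁺ [] p q = contradiction (≤-trans p q) λ ()
∈-points⁺ {k} {j} (x ∷ xs) p q with k ≟ x
... | no _ = there (∈-points⁺ xs p q)
... | yes refl with m≤n⇒m<n∨m≡n q
...   | inj₁ (s≤s j≤) = there (∈-points⁺ xs p j≤)
...   | inj₂ refl = here refl

points-unique : ∀ xs → Unique (points xs)
points-unique []       = []
points-unique (x ∷ xs) =
  -- The label of the head exceeds the multiplicity of `x` in the tail, which bounds all later
  -- labels of `x`.
  All.tabulate (λ { i refl → <-irrefl refl (proj₂ (∈-points⁻ xs i)) }) ∷ points-unique xs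

-- Turns a sum of lengths into the size of a set, which bijections can then reach.
card-pointed : ∀ {K n L} → Enumerates (λ _ → K) n L → Card (Pointed K n) (totalParts L)
card-pointed {K} {n} {L} (u , s , c) = record
  { elements = allPoints L
  ; unique   = allPoints-unique u
  ; sound    = All.tabulate λ i → sound (∈-allPoints⁻ L i)
  ; complete = λ { (pointed p k 1≤j j≤) → ∈-allPoints⁺ (c _ p k) (∈-points⁺ _ 1≤j j≤) }
  ; size     = length-allPoints L
  }
  where
  allPoints : List (List ℕ) → List Triple
  allPoints []       = []
  allPoints (xs ∷ L) = map (xs ,_) (points xs) ++ allPoints L

  length-allPoints : ∀ L → length (allPoints L) ≡ totalParts L
  length-allPoints []       = refl
  length-allPoints (xs ∷ L) = trans (length-++ (map (xs ,_) (points xs)))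
    (cong₂ _+_ (trans (length-map _ (points xs)) (length-points xs)) (length-allPoints L))

  ∈-allPoints⁻ : ∀ {xs p} L → (xs , p) ∈ allPoints L → xs ∈ L × p ∈ points xs
  ∈-allPoints⁻ (ys ∷ L) i with ∈-++⁻ (map (ys ,_) (points ys)) i
  ... | inj₂ i′ = let m , p = ∈-allPoints⁻ L i′ in there m , p
  ... | inj₁ i′ with ∈-map⁻ (ys ,_) i′
  ...   | _ , p , refl = here refl , p

  ∈-allPoints⁺ : ∀ {xs p L} → xs ∈ L → p ∈ points xs → (xs , p) ∈ allPoints L
  ∈-allPoints⁺ (here refl) i = ∈-++⁺ˡ (∈-map⁺ _ i)
  ∈-allPoints⁺ {L = ys ∷ L} (there m) i = ∈-++⁺ʳ (map (ys ,_) (points ys)) (∈-allPoints⁺ m i)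

  allPoints-unique : ∀ {L} → Unique L → Unique (allPoints L)
  allPoints-unique [] = []
  allPoints-unique {xs ∷ L} (xs∉ ∷ u) =
    Unique.++⁺ (Unique.map⁺ (cong proj₂) (points-unique xs)) (allPoints-unique u) disjoint
    where
    disjoint : ∀ {t} → ¬ (t ∈ map (xs ,_) (points xs) × t ∈ allPoints L)
    disjoint (i , i′) with ∈-map⁻ (xs ,_) i
    ... | _ , _ , refl = All.lookup xs∉ (proj₁ (∈-allPoints⁻ L i′)) refl

  sound : ∀ {t} → proj₁ t ∈ L × proj₂ t ∈ points (proj₁ t) → Pointed K n t
  sound (m , i) = let p , k = s _ m ; 1≤j , j≤ = ∈-points⁻ _ i in pointed p k 1≤j j≤

-- Selecting the `j`-th copy of `k` amounts to detaching `j` copies of `k` as a block. The two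
-- hypotheses say that `R` describes exactly what may remain.
card-marked-pointed : ∀ {K R n} →
  (∀ {xs k j} → R xs k j → K (add k j xs)) →
  (∀ {xs k j} → K xs → 1 ≤ j → j ≤ mult k xs → R (remove k j xs) k j) →
  Card (Pointed K n) a → Card (Marked R n) a
card-marked-pointed {K = K} {R} {n} R⇒K K⇒R = card-pullback (λ (xs , k , j) → add k j xs , k , j) to injective onto
  where
  to : ∀ {t} → Marked R n t → Pointed K n (add (proj₁ (proj₂ t)) (proj₂ (proj₂ t)) (proj₁ t) , proj₂ t)
  to (marked {xs} {k} {j} v 1≤k 1≤j r eq) =
    pointed (partition (add-valid j 1≤k v) (trans (sum-add k j xs) eq)) (R⇒K r) 1≤j (mult≤mult-add k j xs)

  injective : ∀ {t t′} → Marked R n t → Marked R n t′ →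
    (add (proj₁ (proj₂ t)) (proj₂ (proj₂ t)) (proj₁ t) , proj₂ t) ≡
    (add (proj₁ (proj₂ t′)) (proj₂ (proj₂ t′)) (proj₁ t′) , proj₂ t′) → t ≡ t′
  injective (marked {_} {k} {j} v _ _ _ _) (marked v′ _ _ _ _) eq with cong proj₂ eq
  ... | refl = cong (_, (k , j)) (add-injective k j v v′ (cong proj₁ eq))

  onto : ∀ {t} → Pointed K n t → ∃ λ s → Marked R n s × (add (proj₁ (proj₂ s)) (proj₂ (proj₂ s)) (proj₁ s) , proj₂ s) ≡ t
  onto (pointed {xs} {k} {j} p kxs 1≤j j≤) =
    (remove k j xs , k , j) ,
    marked (remove-valid j 1≤k (valid p)) 1≤k 1≤j (K⇒R kxs 1≤j j≤)
      (trans (sum-remove k (valid p) j≤) (IsPartition.sums p)) ,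
    cong (_, (k , j)) (add-remove k (valid p) j≤)
    where 1≤k = mult⇒positive (valid p) (≤-trans 1≤j j≤)

-- The identity o = O·F: detaching any number of copies of an odd part leaves an arbitrary partition
-- into odd parts.
card-odd-pointed : ∀ {n L} → Enumerates (λ _ → AllOdd) n L →
  Card (Marked (λ xs k _ → OddParts xs × Odd k) n) (totalParts L)
card-odd-pointed enum = card-marked-pointed
  (λ {xs} {k} {j} (odd , k-odd) → oddParts⇒allOdd λ r →
    trans (mult-add-≢ j xs λ { refl → even-odd-⊥ {r * 2} (double-even r) k-odd }) (odd r))
  (λ {xs} {k} {j} odd 1≤j j≤ →
    (λ r → n≤0⇒n≡0 (≤-trans (mult-remove-≤ (r * 2) k j xs) (≤-reflexive (allOdd⇒oddParts odd r)))) ,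
    All.lookup odd (mult⇒∈ xs (≤-trans 1≤j j≤)))
  (card-pointed enum)

-- A selected part of a distinct partition is the only copy of its value, so the block has one
-- element and the rest avoids `k`.
card-distinct-pointed : ∀ {n L} → Enumerates (λ _ → Distinct) n L →
  Card (Marked (λ xs k j → DistinctParts xs × mult k xs ≡ 0 × j ≡ 1) n) (totalParts L)
card-distinct-pointed enum = card-marked-pointed
  (λ {xs} {k} {j} (d , m , j≡1) → distinctParts⇒unique (add-distinct xs k j d m j≡1))
  (λ {xs} {k} {j} u 1≤j j≤ →
    let d = unique⇒distinctParts u ; j≡1 = ≤-antisym (≤-trans j≤ (d k)) 1≤j in
    (λ v → ≤-trans (mult-remove-≤ v k j xs) (d v)) ,
    trans (mult-remove-≡ k j xs) (m≤n⇒m∸n≡0 (≤-trans (d k) 1≤j)) ,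
    j≡1)
  (card-pointed enum)
  where
  add-distinct : ∀ xs k j → DistinctParts xs → mult k xs ≡ 0 → j ≡ 1 → DistinctParts (add k j xs)
  add-distinct xs k j d m refl v with v ≟ k
  ... | yes refl = ≤-reflexive (trans (mult-add-≡ k 1 xs) (cong suc m))
  ... | no ne    = ≤-trans (≤-reflexive (mult-add-≢ 1 xs ne)) (d v)

-- Partitions with one even value

-- The identity a = O·E: all copies of the even value form the block. Conversely `k` is recovered as
-- the only even value and `j` as its multiplicity.
card-even-marked : ∀ {n L} → Enumerates (λ _ → ExactlyOneEvenValue) n L →
  Card (Marked (λ xs k _ → OddParts xs × Even k) n) (length L)
card-even-marked {n} enum = card-pullback insert to injective onto (card-enumerated enum)
  where
  insert : Triple → List ℕ
  insert (xs , k , j) = add k j xs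

  onlyEven : ∀ {xs k} j → OddParts xs → ∀ {v} → v ∈ add k j xs → Even v → v ≡ k
  onlyEven {xs} {k} j odd {v} i e with v ≟ k
  ... | yes eq = eq
  ... | no ne  = contradiction (trans (mult-add-≢ j xs ne) (oddParts⇒¬even {v} {xs} odd e)) (≢-sym (<⇒≢ (∈⇒mult i)))

  k∈add : ∀ k {j} xs → 1 ≤ j → k ∈ add k j xs
  k∈add k {j} xs 1≤j = mult⇒∈ (add k j xs) (≤-trans 1≤j (mult≤mult-add k j xs))

  to : ∀ {t} → Marked (λ xs k _ → OddParts xs × Even k) n t → IsPartition n (insert t) × ExactlyOneEvenValue (insert t)
  to (marked {xs} {k} {j} v 1≤k 1≤j (odd , e) eq) =
    partition (add-valid j 1≤k v) (trans (sum-add k j xs) eq) ,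
    k , e , k∈add k xs 1≤j , All.tabulate (onlyEven j odd)

  injective : ∀ {t t′} → Marked (λ xs k _ → OddParts xs × Even k) n t → Marked (λ xs k _ → OddParts xs × Even k) n t′ →
    insert t ≡ insert t′ → t ≡ t′
  injective (marked {xs} {k} {j} v _ 1≤j (odd , e) _) (marked {xs′} {k′} {j′} v′ _ _ (odd′ , _) _) eq
    -- `k` is an even part of the second partition as well, whose only even value is `k′`.
    with onlyEven j′ odd′ (subst (k ∈_) eq (k∈add k xs 1≤j)) e
  ... | refl with trans (sym (copies xs j odd)) (trans (cong (mult k) eq) (copies xs′ j′ odd′))
    where
    copies : ∀ xs j → OddParts xs → mult k (add k j xs) ≡ j
    copies xs j odd = trans (mult-add-≡ k j xs) (trans (cong (j +_) (oddParts⇒¬even {k} {xs} odd e)) (+-identityʳ j))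
  ...   | refl = cong (_, (k , j)) (add-injective k j v v′ eq)

  onto : ∀ {xs} → IsPartition n xs × ExactlyOneEvenValue xs →
    ∃ λ t → Marked (λ xs k _ → OddParts xs × Even k) n t × insert t ≡ xs
  onto {xs} (p , k , e , k∈ , only) =
    (remove k m xs , k , m) ,
    marked (remove-valid m 1≤k (valid p)) 1≤k (∈⇒mult k∈) (odd , e)
      (trans (sum-remove k (valid p) ≤-refl) (IsPartition.sums p)) ,
    add-remove k (valid p) ≤-refl
    where
    m = mult k xs
    1≤k = mult⇒positive (valid p) (∈⇒mult k∈)
    odd : OddParts (remove k m xs)
    odd r with r * 2 ≟ k
    ... | yes eq = trans (cong (λ v → mult v (remove k m xs)) eq) (trans (mult-remove-≡ k m xs) (n∸n≡0 m))
    ... | no ne  = trans (mult-remove-≢ m xs ne) (∉⇒mult≡0 xs λ i → ne (All.lookup only i (double-even r)))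

-- Partitions with one repeated part

-- G selects, for every multiplicity m ≥ 2 of the repeated part, exactly one way of writing m = j + b with b ≤ 1.
module _ (G : ℕ → ℕ → Set)
  (repeated   : ∀ {b j} → 1 ≤ j → G b j → 2 ≤ j + b)
  (determined : ∀ {b c j i} → b ≤ 1 → c ≤ 1 → G b j → G c i → j + b ≡ i + c → j ≡ i)
  (decompose  : ∀ m → 2 ≤ m → ∃ λ j → 1 ≤ j × j ≤ m × m ∸ j ≤ 1 × G (m ∸ j) j)
  where

  private
    R : List ℕ → ℕ → ℕ → Set
    R xs k j = DistinctParts xs × G (mult k xs) j

    insert : Triple → List ℕ
    insert (xs , k , j) = add k j xs

  -- The block value is recovered as the only repeated value. Its multiplicity is j + b, from which
  -- `determined` recovers j.
  card-repeated-marked : ∀ {n L} → Enumerates (λ _ → ExactlyOneRepeated) n L → Card (Marked R n) (length L)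
  card-repeated-marked {n} enum = card-pullback insert to injective onto (card-enumerated enum)
    where
    onlyRepeated : ∀ {xs} k j → DistinctParts xs → ∀ v → 2 ≤ mult v (add k j xs) → v ≡ k
    onlyRepeated {xs} k j d v 2≤ with v ≟ k
    ... | yes eq = eq
    ... | no ne  = contradiction (d v) (<⇒≱ (subst (2 ≤_) (mult-add-≢ j xs ne) 2≤))

    2≤mult : ∀ {xs} k {j} → 1 ≤ j → G (mult k xs) j → 2 ≤ mult k (add k j xs)
    2≤mult {xs} k {j} 1≤j g = subst (2 ≤_) (sym (mult-add-≡ k j xs)) (repeated 1≤j g)

    to : ∀ {t} → Marked R n t → IsPartition n (insert t) × ExactlyOneRepeated (insert t)
    to (marked {xs} {k} {j} v 1≤k 1≤j (d , g) eq) =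
      partition (add-valid j 1≤k v) (trans (sum-add k j xs) eq) ,
      k , 2≤mult k 1≤j g , onlyRepeated k j d

    injective : ∀ {t t′} → Marked R n t → Marked R n t′ → insert t ≡ insert t′ → t ≡ t′
    injective (marked {xs} {k} {j} v _ 1≤j (d , g) _) (marked {xs′} {k′} {j′} v′ _ _ (d′ , g′) _) eq
      with onlyRepeated k′ j′ d′ k (subst (λ ys → 2 ≤ mult k ys) eq (2≤mult k 1≤j g))
    ... | refl with determined (d k) (d′ k) g g′
                      (trans (sym (mult-add-≡ k j xs)) (trans (cong (mult k) eq) (mult-add-≡ k j′ xs′)))
    ...   | refl = cong (_, (k , j)) (add-injective k j v v′ eq)

    onto : ∀ {xs} → IsPartition n xs × ExactlyOneRepeated xs → ∃ λ t → Marked R n t × insert t ≡ xs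
    onto {xs} (p , k , 2≤ , only) with decompose (mult k xs) 2≤
    ... | j , 1≤j , j≤ , b≤1 , g =
      (remove k j xs , k , j) ,
      marked (remove-valid j 1≤k (valid p)) 1≤k 1≤j
        (distinct , subst (λ b → G b j) (sym (mult-remove-≡ k j xs)) g)
        (trans (sum-remove k (valid p) j≤) (IsPartition.sums p)) ,
      add-remove k (valid p) j≤
      where
      1≤k = mult⇒positive (valid p) (≤-trans (s≤s z≤n) 2≤)
      distinct : DistinctParts (remove k j xs)
      distinct v with v ≟ k
      ... | yes refl = ≤-trans (≤-reflexive (mult-remove-≡ k j xs)) b≤1
      ... | no ne    = ≤-trans (mult-remove-≤ v k j xs) (≤-pred (≰⇒> λ 2≤v → ne (only v 2≤v)))

-- The splitting m = m + 0: the block takes all copies.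
card-repeated-absent : ∀ {n L} → Enumerates (λ _ → ExactlyOneRepeated) n L →
  Card (Marked (λ xs k j → DistinctParts xs × mult k xs ≡ 0 × 2 ≤ j) n) (length L)
card-repeated-absent = card-repeated-marked (λ b j → b ≡ 0 × 2 ≤ j)
  (λ { _ (_ , 2≤j) → ≤-trans 2≤j (m≤m+n _ _) })
  (λ { _ _ (refl , _) (refl , _) eq → +-cancelʳ-≡ 0 _ _ eq })
  (λ m 2≤m → m , ≤-trans (s≤s z≤n) 2≤m , ≤-refl , ≤-trans (≤-reflexive (n∸n≡0 m)) z≤n , n∸n≡0 m , 2≤m)

-- The splitting m = (m - 1) + 1: one copy stays behind.
card-repeated-present : ∀ {n L} → Enumerates (λ _ → ExactlyOneRepeated) n L →
  Card (Marked (λ xs k j → DistinctParts xs × mult k xs ≡ 1) n) (length L)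
card-repeated-present = card-repeated-marked (λ b j → b ≡ 1)
  (λ { 1≤j refl → +-monoˡ-≤ 1 1≤j })
  (λ { _ _ refl refl eq → +-cancelʳ-≡ 1 _ _ eq })
  (λ { (suc m) (s≤s 1≤m) → m , 1≤m , n≤1+n m , ≤-reflexive (m+n∸n≡m 1 m) , m+n∸n≡m 1 m })

-- The splitting of m into 2⌊m/2⌋ and its remainder modulo 2. Blocks of even length can afterwards
-- be traded for blocks of an even part.
card-repeated-even-block : ∀ {n L} → Enumerates (λ _ → ExactlyOneRepeated) n L →
  Card (Marked (λ xs k j → DistinctParts xs × Even j) n) (length L)
card-repeated-even-block = card-repeated-marked (λ _ j → Even j)
  (λ { {j = suc (suc _)} _ _ → s≤s (s≤s z≤n) })
  determined
  decompose
  where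
  determined : ∀ {b c j i} → b ≤ 1 → c ≤ 1 → Even j → Even i → j + b ≡ i + c → j ≡ i
  determined {b} {c} {j} {i} b≤ c≤ ej ei eq = trans (even⇒double {j} ej) (trans (cong (_* 2) halves) (sym (even⇒double {i} ei)))
    where
    halves : j / 2 ≡ i / 2
    halves = double-+-injective (j / 2) (i / 2) b≤ c≤
      (trans (cong (_+ b) (sym (even⇒double {j} ej))) (trans eq (cong (_+ c) (even⇒double {i} ei))))

  decompose : ∀ m → 2 ≤ m → ∃ λ j → 1 ≤ j × j ≤ m × m ∸ j ≤ 1 × Even j
  decompose m 2≤m = m / 2 * 2 , ≮⇒≥ nonzero , m/n*n≤m m 2 , rest , double-even (m / 2)
    where
    rest : m ∸ m / 2 * 2 ≤ 1
    rest = subst (_≤ 1) (m%n≡m∸m/n*n m 2) (≤-pred (m%n<n m 2))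
    -- An empty block would leave a remainder of m, which is at least 2.
    nonzero : ¬ (m / 2 * 2 < 1)
    nonzero lt = <⇒≱ 2≤m (subst (λ z → m ∸ z ≤ 1) (n<1⇒n≡0 lt) rest)

-- k copies of 2r carry the same weight as 2k copies of r.
card-repeated-even : ∀ {n L} → Enumerates (λ _ → ExactlyOneRepeated) n L →
  Card (Marked (λ xs k _ → DistinctParts xs × Even k) n) (length L)
card-repeated-even {n} enum = card-pullback halve to injective onto (card-repeated-even-block enum)
  where
  halve : Triple → Triple
  halve (xs , k , j) = xs , k / 2 , j * 2

  weight : ∀ {k} j → Even k → k / 2 * (j * 2) ≡ k * j
  weight {k} j e = trans (cong (k / 2 *_) (*-comm j 2)) (trans (sym (*-assoc (k / 2) 2 j)) (cong (_* j) (sym (even⇒double {k} e))))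

  positive-half : ∀ {k} → 1 ≤ k → Even k → 1 ≤ k / 2
  positive-half {k} 1≤k e = ≮⇒≥ λ lt → contradiction
    (trans (even⇒double {k} e) (cong (_* 2) (n<1⇒n≡0 lt))) (≢-sym (<⇒≢ 1≤k))

  to : ∀ {t} → Marked (λ xs k _ → DistinctParts xs × Even k) n t → Marked (λ xs k j → DistinctParts xs × Even j) n (halve t)
  to (marked {xs} {k} {j} v 1≤k 1≤j (d , e) eq) =
    marked v (positive-half {k} 1≤k e) (≤-trans 1≤j (m≤m*n j 2)) (d , double-even j)
      (trans (cong (sum xs +_) (weight {k} j e)) eq)

  injective : ∀ {t t′} → Marked (λ xs k _ → DistinctParts xs × Even k) n t → Marked (λ xs k _ → DistinctParts xs × Even k) n t′ →
    halve t ≡ halve t′ → t ≡ t′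
  injective (marked {xs} {k} {j} _ _ _ (_ , e) _) (marked {xs′} {k′} {j′} _ _ _ (_ , e′) _) eq =
    cong₂ _,_ (cong proj₁ eq) (cong₂ _,_
      (trans (even⇒double {k} e) (trans (cong (_* 2) (cong (proj₁ ∘ proj₂) eq)) (sym (even⇒double {k′} e′))))
      (*-cancelʳ-≡ j j′ 2 (cong (proj₂ ∘ proj₂) eq)))

  onto : ∀ {t} → Marked (λ xs k j → DistinctParts xs × Even j) n t →
    ∃ λ s → Marked (λ xs k _ → DistinctParts xs × Even k) n s × halve s ≡ t
  onto (marked {xs} {r} {j} v 1≤r 1≤j (d , e) eq) =
    (xs , r * 2 , j / 2) ,
    marked v (≤-trans 1≤r (m≤m*n r 2)) (positive-half {j} 1≤j e) (d , double-even r)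
      (trans (cong (sum xs +_) weight′) eq) ,
    cong₂ (λ a b → xs , a , b) (m*n/n≡m r 2) (sym (even⇒double {j} e))
    where
    weight′ : r * 2 * (j / 2) ≡ r * j
    weight′ = trans (*-assoc r 2 (j / 2)) (cong (r *_) (trans (*-comm 2 (j / 2)) (sym (even⇒double {j} e))))

-- Glaisher's bijection, one doubling at a time

-- Interpolates between partitions into odd parts (N = 0) and into distinct parts (N large).
Partway : ℕ → List ℕ → Set
Partway N xs = (∀ v → v ≤ N → mult v xs ≤ 1) × (∀ r → N < r → mult (r * 2) xs ≡ 0)

-- Replaces every 2M by two copies of M; on partitions with at most one M this is undone by halving the multiplicity of M.
break : ℕ → List ℕ → List ℕ
break M xs = add M (mult (M * 2) xs * 2) (remove (M * 2) (mult (M * 2) xs) xs)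

module _ {N : ℕ} where
  private
    M : ℕ
    M = suc N

    M≢2M : M ≢ M * 2
    M≢2M eq = contradiction (*-cancelˡ-≡ 1 2 M (trans (*-identityʳ M) eq)) λ ()

  break-valid : ∀ {xs} → Valid xs → Valid (break M xs)
  break-valid {xs} v = add-valid _ (s≤s z≤n) (remove-valid (mult (M * 2) xs) (s≤s z≤n) v)

  mult-break-M : ∀ xs → mult M (break M xs) ≡ mult (M * 2) xs * 2 + mult M xs
  mult-break-M xs = trans (mult-add-≡ M _ (remove (M * 2) m xs)) (cong (m * 2 +_) (mult-remove-≢ m xs M≢2M))
    where m = mult (M * 2) xs

  mult-break-2M : ∀ xs → mult (M * 2) (break M xs) ≡ 0
  mult-break-2M xs = trans (mult-add-≢ _ (remove (M * 2) m xs) (≢-sym M≢2M)) (trans (mult-remove-≡ (M * 2) m xs) (n∸n≡0 m))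
    where m = mult (M * 2) xs

  mult-break-≢ : ∀ {v} xs → v ≢ M → v ≢ M * 2 → mult v (break M xs) ≡ mult v xs
  mult-break-≢ xs ne ne₂ = trans (mult-add-≢ _ (remove (M * 2) m xs) ne) (mult-remove-≢ m xs ne₂)
    where m = mult (M * 2) xs

  sum-break : ∀ {xs} → Valid xs → sum (break M xs) ≡ sum xs
  sum-break {xs} v = begin
    sum (break M xs)                              ≡⟨ sum-add M (m * 2) (remove (M * 2) m xs) ⟩
    sum (remove (M * 2) m xs) + M * (m * 2)       ≡⟨ cong (λ z → sum (remove (M * 2) m xs) + M * z) (*-comm m 2) ⟩
    sum (remove (M * 2) m xs) + M * (2 * m)       ≡⟨ cong (sum (remove (M * 2) m xs) +_) (*-assoc M 2 m) ⟨
    sum (remove (M * 2) m xs) + M * 2 * m         ≡⟨ sum-remove (M * 2) v ≤-refl ⟩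
    sum xs                                        ∎
    where
    open ≡-Reasoning
    m = mult (M * 2) xs

  -- The step gives up the bound on copies of `M` and in exchange excludes `M * 2`; the other
  -- conditions concern values it leaves alone.
  break-partway : ∀ {xs} → Partway M xs → Partway N (break M xs)
  break-partway {xs} (small , large) = small′ , large′
    where
    small′ : ∀ v → v ≤ N → mult v (break M xs) ≤ 1
    small′ v v≤N = ≤-trans
      (≤-reflexive (mult-break-≢ xs (<⇒≢ (s≤s v≤N)) (<⇒≢ (≤-trans (s≤s v≤N) (m≤m*n M 2)))))
      (small v (m≤n⇒m≤1+n v≤N))
    large′ : ∀ r → N < r → mult (r * 2) (break M xs) ≡ 0
    large′ r M≤r with m≤n⇒m<n∨m≡n M≤r
    ... | inj₂ refl = mult-break-2M xs
    ... | inj₁ M<r  = trans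
      (mult-break-≢ xs (≢-sym (<⇒≢ (≤-trans M<r (m≤m*n r 2)))) (≢-sym (<⇒≢ (*-monoˡ-< 2 M<r))))
      (large r M<r)

  -- The image has 2m + b copies of `M` with b at most 1, where m counts the broken parts. So m is
  -- determined, and the inserted copies of `M` cancel.
  break-injective : ∀ {xs ys} → Valid xs → Valid ys → Partway M xs → Partway M ys →
    break M xs ≡ break M ys → xs ≡ ys
  break-injective {xs} {ys} vx vy (sx , _) (sy , _) eq = begin
    xs                                       ≡⟨ add-remove (M * 2) vx ≤-refl ⟨
    add (M * 2) m (remove (M * 2) m xs)      ≡⟨ cong₂ (add (M * 2)) m≡m′ rest ⟩
    add (M * 2) m′ (remove (M * 2) m′ ys)    ≡⟨ add-remove (M * 2) vy ≤-refl ⟩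
    ys                                       ∎
    where
    open ≡-Reasoning
    m  = mult (M * 2) xs
    m′ = mult (M * 2) ys
    m≡m′ : m ≡ m′
    m≡m′ = double-+-injective m m′ (sx M ≤-refl) (sy M ≤-refl)
      (trans (sym (mult-break-M xs)) (trans (cong (mult M) eq) (mult-break-M ys)))
    rest : remove (M * 2) m xs ≡ remove (M * 2) m′ ys
    rest = add-injective M (m * 2) (remove-valid m (s≤s z≤n) vx) (remove-valid m′ (s≤s z≤n) vy)
      (trans eq (cong (λ z → add M (z * 2) (remove (M * 2) m′ ys)) (sym m≡m′)))

  -- Copies of `M` are merged in pairs into `h` parts `M * 2`, leaving at most one `M`.
  break-surjective : ∀ {ys} → Valid ys → Partway N ys → ∃ λ xs → Valid xs × Partway M xs × break M xs ≡ ys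
  break-surjective {ys} v (small , large) = xs , valid-xs , (small′ , large′) , broken
    where
    c = mult M ys
    h = c / 2
    rest = remove M (h * 2) ys
    xs = add (M * 2) h rest
    valid-rest : Valid rest
    valid-rest = remove-valid (h * 2) (s≤s z≤n) v
    valid-xs : Valid xs
    valid-xs = add-valid h (s≤s z≤n) valid-rest

    mult-xs : ∀ {w} → w ≢ M → w ≢ M * 2 → mult w xs ≡ mult w ys
    mult-xs ne ne₂ = trans (mult-add-≢ h rest ne₂) (mult-remove-≢ (h * 2) ys ne)

    small′ : ∀ w → w ≤ M → mult w xs ≤ 1
    small′ w w≤M with m≤n⇒m<n∨m≡n w≤M
    ... | inj₁ w<M = ≤-trans (≤-reflexive (mult-xs (<⇒≢ w<M) (<⇒≢ (≤-trans w<M (m≤m*n M 2))))) (small w (≤-pred w<M))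
    ... | inj₂ refl = ≤-trans
      (≤-reflexive (trans (mult-add-≢ h rest M≢2M) (trans (mult-remove-≡ M (h * 2) ys) (sym (m%n≡m∸m/n*n c 2)))))
      (≤-pred (m%n<n c 2))

    large′ : ∀ r → M < r → mult (r * 2) xs ≡ 0
    large′ r M<r = trans
      (mult-xs (≢-sym (<⇒≢ (≤-trans M<r (m≤m*n r 2)))) (≢-sym (<⇒≢ (*-monoˡ-< 2 M<r))))
      (large r (<⇒≤ M<r))

    -- `ys` has no part `M * 2`, so those of `xs` are precisely the merged pairs, and `break` splits
    -- exactly these.
    mult-2M : mult (M * 2) xs ≡ h
    mult-2M = trans (mult-add-≡ (M * 2) h rest) (trans
      (cong (h +_) (trans (mult-remove-≢ (h * 2) ys (≢-sym M≢2M)) (large M ≤-refl)))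
      (+-identityʳ h))

    broken : break M xs ≡ ys
    broken = begin
      add M (mult (M * 2) xs * 2) (remove (M * 2) (mult (M * 2) xs) xs)
        ≡⟨ cong (λ m → add M (m * 2) (remove (M * 2) m xs)) mult-2M ⟩
      add M (h * 2) (remove (M * 2) h xs)
        ≡⟨ cong (add M (h * 2)) (remove-add h (s≤s z≤n) valid-rest) ⟩
      add M (h * 2) rest
        ≡⟨ add-remove M v (m/n*n≤m c 2) ⟩
      ys ∎
      where open ≡-Reasoning

-- Transfer from odd to distinct parts beside a fixed block

module _ {E : ℕ → Set} {n : ℕ} where

  card-break : ∀ {N} → Card (Marked (λ xs k _ → Partway N xs × E k) n) a →
    Card (Marked (λ xs k _ → Partway (suc N) xs × E k) n) a
  card-break {N = N} = card-pullback f to injective onto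
    where
    f : Triple → Triple
    f (xs , kj) = break (suc N) xs , kj
    to : ∀ {t} → Marked (λ xs k _ → Partway (suc N) xs × E k) n t → Marked (λ xs k _ → Partway N xs × E k) n (f t)
    to (marked {xs} v 1≤k 1≤j (p , e) eq) =
      marked (break-valid v) 1≤k 1≤j (break-partway {xs = xs} p , e) (trans (cong (_+ _) (sum-break v)) eq)
    injective : ∀ {t t′} → Marked (λ xs k _ → Partway (suc N) xs × E k) n t → Marked (λ xs k _ → Partway (suc N) xs × E k) n t′ →
      f t ≡ f t′ → t ≡ t′
    injective (marked v _ _ (p , _) _) (marked v′ _ _ (p′ , _) _) eq =
      cong₂ _,_ (break-injective v v′ p p′ (cong proj₁ eq)) (cong proj₂ eq)
    onto : ∀ {t} → Marked (λ xs k _ → Partway N xs × E k) n t →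
      ∃ λ s → Marked (λ xs k _ → Partway (suc N) xs × E k) n s × f s ≡ t
    onto (marked {xs} {k} {j} v 1≤k 1≤j (p , e) eq) with break-surjective v p
    ... | ys , v′ , p′ , refl = (ys , k , j) ,
      marked v′ 1≤k 1≤j (p′ , e) (trans (cong (_+ k * j) (sym (sum-break v′))) eq) , refl

  card-partway : ∀ N → Card (Marked (λ xs k _ → Partway 0 xs × E k) n) a →
    Card (Marked (λ xs k _ → Partway N xs × E k) n) a
  card-partway zero    = id
  card-partway (suc N) = card-break ∘ card-partway N

  -- Stage 0 consists of the partitions into odd parts. After n steps all values up to n occur at
  -- most once, and larger values cannot occur in a partition of weight at most n. The block is
  -- never touched, so any condition `E` on its value is preserved.
  card-odd⇒distinct : Card (Marked (λ xs k _ → OddParts xs × E k) n) a →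
    Card (Marked (λ xs k _ → DistinctParts xs × E k) n) a
  card-odd⇒distinct = card-⇔ distinct⇒partway partway⇒distinct ∘ card-partway n ∘ card-⇔ partway⇒odd odd⇒partway
    where
    no-zeros : ∀ {xs} → Valid xs → mult 0 xs ≡ 0
    no-zeros (_ , pos) = ∉⇒mult≡0 _ λ i → contradiction (All.lookup pos i) λ ()

    beyond : ∀ xs {v} m → sum xs + m ≡ n → n < v → mult v xs ≡ 0
    beyond xs m eq = mult-beyond-sum xs (≤-trans (m≤m+n _ m) (≤-reflexive eq))

    odd⇒partway : ∀ {t} → Marked (λ xs k _ → OddParts xs × E k) n t → Marked (λ xs k _ → Partway 0 xs × E k) n t
    odd⇒partway (marked v 1≤k 1≤j (odd , e) eq) =
      marked v 1≤k 1≤j (((λ { _ z≤n → ≤-trans (≤-reflexive (no-zeros v)) z≤n }) , (λ r _ → odd r)) , e) eq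

    partway⇒odd : ∀ {t} → Marked (λ xs k _ → Partway 0 xs × E k) n t → Marked (λ xs k _ → OddParts xs × E k) n t
    partway⇒odd (marked v 1≤k 1≤j ((_ , large) , e) eq) =
      -- Stage 0 is silent about the double of 0, but 0 is never a part.
      marked v 1≤k 1≤j ((λ { zero → no-zeros v ; (suc r) → large (suc r) (s≤s z≤n) }) , e) eq

    distinct⇒partway : ∀ {t} → Marked (λ xs k _ → DistinctParts xs × E k) n t → Marked (λ xs k _ → Partway n xs × E k) n t
    distinct⇒partway (marked {xs} v 1≤k 1≤j (d , e) eq) =
      marked v 1≤k 1≤j (((λ w _ → d w) , λ r n<r → beyond xs _ eq (≤-trans n<r (m≤m*n r 2))) , e) eq

    partway⇒distinct : ∀ {t} → Marked (λ xs k _ → Partway n xs × E k) n t → Marked (λ xs k _ → DistinctParts xs × E k) n t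
    partway⇒distinct (marked {xs} v 1≤k 1≤j ((small , _) , e) eq) = marked v 1≤k 1≤j (distinct , e) eq
      where
      distinct : DistinctParts xs
      distinct w with w ≤? n
      ... | yes w≤n = small w w≤n
      ... | no w≰n  = ≤-trans (≤-reflexive (beyond xs _ eq (≰⇒> w≰n))) z≤n

-- Two counts of partitions with an arbitrary block

card-marked-⊎ : ∀ {R S T n} → Card (Marked R n) a → Card (Marked S n) b →
  (∀ {xs k j} → R xs k j → ¬ S xs k j) →
  (∀ {xs k j} → 1 ≤ j → T xs k j → R xs k j ⊎ S xs k j) →
  (∀ {xs k j} → R xs k j → T xs k j) →
  (∀ {xs k j} → S xs k j → T xs k j) →
  Card (Marked T n) (a + b)
card-marked-⊎ c d disjoint cover R⊆T S⊆T = card-⇔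
  (λ { (marked v 1≤k 1≤j t eq) → classify v 1≤k 1≤j eq (cover 1≤j t) })
  (λ { (inj₁ (marked v 1≤k 1≤j r eq)) → marked v 1≤k 1≤j (R⊆T r) eq
     ; (inj₂ (marked v 1≤k 1≤j s eq)) → marked v 1≤k 1≤j (S⊆T s) eq })
  (card-⊎ c d λ { (marked _ _ _ r _) (marked _ _ _ s _) → disjoint r s })
  where
  classify : ∀ {R S n xs k j} → Valid xs → 1 ≤ k → 1 ≤ j → sum xs + k * j ≡ n →
    R xs k j ⊎ S xs k j → Marked R n (xs , k , j) ⊎ Marked S n (xs , k , j)
  classify v 1≤k 1≤j eq (inj₁ r) = inj₁ (marked v 1≤k 1≤j r eq)
  classify v 1≤k 1≤j eq (inj₂ s) = inj₂ (marked v 1≤k 1≤j s eq)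

-- The identity a + o = O·(E + F), by the parity of the block value. The factor `⊤` is the trivial
-- condition `E` for `card-odd⇒distinct`.
card-odd : ∀ {n A O} → Enumerates (λ _ → ExactlyOneEvenValue) n A → Enumerates (λ _ → AllOdd) n O →
  Card (Marked (λ xs _ _ → OddParts xs × ⊤) n) (length A + totalParts O)
card-odd A O = card-marked-⊎ (card-even-marked A) (card-odd-pointed O)
  (λ { {k = k} (_ , e) (_ , o) → even-odd-⊥ {k} e o })
  (λ { {k = k} _ (odd , _) → Sum.map (odd ,_) (odd ,_) (parity k) })
  (λ (odd , _) → odd , tt)
  (λ (odd , _) → odd , tt)

-- The identity D·(E + F) = d + 2c. If `k` is absent from `xs`, a block of length 1 gives a selected
-- part and a longer one a repeated part; if `k` is present, every block gives a repeated part.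
card-distinct : ∀ {n C D} → Enumerates (λ _ → ExactlyOneRepeated) n C → Enumerates (λ _ → Distinct) n D →
  Card (Marked (λ xs _ _ → DistinctParts xs × ⊤) n) (totalParts D + length C + length C)
card-distinct C D = card-marked-⊎ absent (card-repeated-present C)
  (λ (_ , m≡0) (_ , m≡1) → 0≢1+n (trans (sym m≡0) m≡1))
  (λ { {xs} {k} _ (d , _) → Sum.map (d ,_) (d ,_) (zero-or-one (d k)) })
  (λ (d , _) → d , tt)
  (λ (d , _) → d , tt)
  where
  zero-or-one : ∀ {m} → m ≤ 1 → m ≡ 0 ⊎ m ≡ 1
  zero-or-one z≤n       = inj₁ refl
  zero-or-one (s≤s z≤n) = inj₂ refl
  one-or-more : ∀ {j} → 1 ≤ j → j ≡ 1 ⊎ 2 ≤ j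
  one-or-more {suc zero}    _ = inj₁ refl
  one-or-more {suc (suc j)} _ = inj₂ (s≤s (s≤s z≤n))
  absent = card-marked-⊎ {T = λ xs k j → DistinctParts xs × mult k xs ≡ 0} (card-distinct-pointed D) (card-repeated-absent C)
    (λ { (_ , _ , refl) (_ , _ , 2≤1) → <-irrefl refl 2≤1 })
    (λ 1≤j (d , m) → Sum.map (λ j → d , m , j) (λ j → d , m , j) (one-or-more 1≤j))
    (λ (d , m , _) → d , m)
    (λ (d , m , _) → d , m)

-- Comparison of the counts

open import Data.Integer using (+_; _-_)

theorem1 : (n : ℕ) → 1 ≤ n →
    (A C O D : List (List ℕ)) →
    Enumerates (λ _ λs → ExactlyOneEvenValue λs) n A →
    Enumerates (λ _ λs → ExactlyOneRepeated λs) n C →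
    Enumerates (λ _ λs → AllOdd λs) n O →
    Enumerates (λ _ λs → Distinct λs) n D →
    (+ length A ≡ + totalParts O - + totalParts D)
    × (+ length C ≡ + totalParts O - + totalParts D)
theorem1 n _ A C O D enumA enumC enumO enumD =
  trans (cong +_ A≡C) C≡O-D , C≡O-D
  where
  -- Both sides count D·E: a by transfer from O·E, c by trading even blocks for even parts.
  A≡C : length A ≡ length C
  A≡C = card-unique (card-odd⇒distinct (card-even-marked enumA)) (card-repeated-even enumC)

  -- One copy of c is cancelled from a + o = d + 2c, using a = c.
  O≡D+C : totalParts O ≡ totalParts D + length C
  O≡D+C = +-cancelʳ-≡ (length C) _ _ (trans (+-comm (totalParts O) (length C))
    (trans (cong (Data.Nat._+ totalParts O) (sym A≡C))
      (card-unique (card-odd⇒distinct (card-odd enumA enumO)) (card-distinct enumC enumD))))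

  C≡O-D : + length C ≡ + totalParts O - + totalParts D
  -- The integer difference is an honest natural one, because o = d + c is at least d.
  C≡O-D = sym (trans (ℤ.m-n≡m⊖n (totalParts O) (totalParts D))
    (trans (cong (Data.Integer._⊖ totalParts D) O≡D+C)
    (trans (ℤ.⊖-≥ (m≤m+n (totalParts D) (length C)))
      (cong +_ (m+n∸m≡n (totalParts D) (length C))))))
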